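{- Let $(G,i)$ be a filter pair over $\Sigma$ and $l=(\Sigma,\vdash^X)$ the associated logic with an infinite set of variables $X$. Let $Z$ be another set and $F\subseteq Fm(Z)$ an $l$-filter. Then $F=i_{Fm(Z)}(\Xi_{Fm(Z)}(F))$. In particular all $l$-filters in absolutely free algebras lie in the image of $i$.
   Context: $\Sigma$-Str is the category of $\Sigma$-structures and homomorphisms; $Fm(X)$ is the absolutely free $\Sigma$-structure on a set $X$. $AL$ is the category of algebraic lattices with maps preserving arbitrary meets and directed joins. A filter pair over $\Sigma$ is a pair $(G,i)$ of a contravariant functor $G:\Sigma\text{ -Str}\to AL$ and maps $i_A:G(A)\to(\mathcal{P}(A),\subseteq)$, one for each $\Sigma$-structure $A$, preserving arbitrary infima (in particular $i_A(\top)=A$) and directed suprema, such that $i_A\circ G(h)=h^{ -1}\circ i_B$ for every homomorphism $h:A\to B$. $\Xi_A:\mathcal{P}(A)\to G(A)$ denotes the left adjoint of $i_A$ ($\Xi_A(D)\leq z\iff D\subseteq i_A(z)$), which exists since $i_A$ preserves infima. The associated logic $(\Sigma,\vdash^X)$: for $\Gamma\cup\{\varphi\}\subseteq Fm(X)$, $\Gamma\vdash^X\varphi$ iff for every $a\in G(Fm(X))$, $\Gamma\subseteq i_{Fm(X)}(a)$ implies $\varphi\in i_{Fm(X)}(a)$. An $l$-filter on a $\Sigma$-structure $A$ is a subset $F\subseteq A$ such that whenever $\Gamma\vdash^X\varphi$ and $v:Fm(X)\to A$ is a homomorphism with $v[\Gamma]\subseteq F$, then $v(\varphi)\in F$. 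-}

module Defs where

open import Level using (Level; _⊔_; Lift; lift) renaming (suc to lsuc)
open import Data.Bool.Base using (Bool; true; false)
open import Data.Fin.Base using (Fin)
open import Data.Nat.Base using (ℕ)
open import Data.Product using (Σ; ∃; _×_; _,_; proj₁; proj₂)
open import Data.Vec.Base using (Vec; []; _∷_; map)
open import Data.Vec.Properties using (map-id; map-∘)
open import Function.Base using (_∘_; id)
open import Function.Bundles using (_↔_; _⇔_; mk⇔)
open import Relation.Binary.Bundles using (Poset)
open import Relation.Binary.PropositionalEquality
  using (_≡_; refl; sym; trans; cong; cong₂; _≗_)
open import Relation.Nullary using (¬_)
open import Relation.Unary using (Pred; _∈_; _⊆_; _≐_; ⋂; ⋃)
  renaming (_⊢_ to _⁻¹[_])

private variable
  ℓ c ℓ₁ ℓ₂ ι r : Level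

------------------------------------------------------------------------
-- Signatures, structures, homomorphisms

-- A (finitary) signature: the n-ary operation symbols, for each n.
Signature : ∀ ℓ → Set (lsuc ℓ)
Signature ℓ = ℕ → Set ℓ

record Structure (S : Signature ℓ) : Set (lsuc ℓ) where
  field
    Carrier : Set ℓ
    op      : ∀ {n} → S n → Vec Carrier n → Carrier

open Structure public using () renaming (Carrier to ∣_∣)

record Hom {S : Signature ℓ} (A B : Structure S) : Set ℓ where
  private
    module A = Structure A
    module B = Structure B
  field
    fun : A.Carrier → B.Carrier
    hom : ∀ {n} (f : S n) (xs : Vec A.Carrier n) →
          fun (A.op f xs) ≡ B.op f (map fun xs)

open Hom public using (fun)

idHom : {S : Signature ℓ} (A : Structure S) → Hom A A
idHom A = record
  { fun = id
  ; hom = λ f xs → cong (Structure.op A f) (sym (map-id xs))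
  }

infixr 9 _∘ʰ_

_∘ʰ_ : {S : Signature ℓ} {A B C : Structure S} → Hom B C → Hom A B → Hom A C
_∘ʰ_ {C = C} g h = record
  { fun = fun g ∘ fun h
  ; hom = λ f xs → trans (cong (fun g) (Hom.hom h f xs))
                   (trans (Hom.hom g f (map (fun h) xs))
                          (cong (Structure.op C f) (sym (map-∘ (fun g) (fun h) xs))))
  }

------------------------------------------------------------------------
-- Absolutely free structures

data Term (S : Signature ℓ) (X : Set ℓ) : Set ℓ where
  var : X → Term S X
  app : ∀ {n} → S n → Vec (Term S X) n → Term S X

Fm : (S : Signature ℓ) → Set ℓ → Structure S
Fm S X = record { Carrier = Term S X ; op = app }

-- The universal property of Fm S X: existence and uniqueness.
module _ {S : Signature ℓ} {X : Set ℓ} (A : Structure S) where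
  open Structure A using (Carrier; op)

  module _ (v : X → Carrier) where
    eval  : Term S X → Carrier
    evals : ∀ {n} → Vec (Term S X) n → Vec Carrier n
    eval (var x)    = v x
    eval (app f ts) = op f (evals ts)
    evals []        = []
    evals (t ∷ ts)  = eval t ∷ evals ts

    evals≡map : ∀ {n} (ts : Vec (Term S X) n) → evals ts ≡ map eval ts
    evals≡map []       = refl
    evals≡map (t ∷ ts) = cong (eval t ∷_) (evals≡map ts)

    extend : Hom (Fm S X) A
    extend = record { fun = eval ; hom = λ f ts → cong (op f) (evals≡map ts) }

  module _ (h : Hom (Fm S X) A) where
    extend-unique  : fun h ≗ eval (fun h ∘ var)
    extends-unique : ∀ {n} (ts : Vec (Term S X) n) →
                     map (fun h) ts ≡ evals (fun h ∘ var) ts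
    extend-unique (var x)    = refl
    extend-unique (app f ts) =
      trans (Hom.hom h f ts) (cong (op f) (extends-unique ts))
    extends-unique []       = refl
    extends-unique (t ∷ ts) = cong₂ _∷_ (extend-unique t) (extends-unique ts)

------------------------------------------------------------------------
-- Algebraic lattices

module _ (P : Poset c ℓ₁ ℓ₂) where
  open Poset P using (Carrier; _≤_)

  IsLub : {I : Set ι} → (I → Carrier) → Carrier → Set (c ⊔ ℓ₂ ⊔ ι)
  IsLub d s = (∀ j → d j ≤ s) × (∀ z → (∀ j → d j ≤ z) → s ≤ z)

  IsGlb : {I : Set ι} → (I → Carrier) → Carrier → Set (c ⊔ ℓ₂ ⊔ ι)
  IsGlb d m = (∀ j → m ≤ d j) × (∀ z → (∀ j → z ≤ d j) → z ≤ m)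

  IsDirected : {I : Set ι} → (I → Carrier) → Set (ℓ₂ ⊔ ι)
  IsDirected {I = I} d =
    I × (∀ j k → ∃ λ l → d j ≤ d l × d k ≤ d l)

-- Subsets of the lattice are given as indexed families.  The index types
-- live in a universe at least as large as that of the carrier, so that all
-- subsets of the carrier are covered; ι allows for further index types.
record CompleteLattice (c ℓ₁ ℓ₂ ι : Level) : Set (lsuc (c ⊔ ℓ₁ ⊔ ℓ₂ ⊔ ι)) where
  field
    poset : Poset c ℓ₁ ℓ₂
  open Poset poset public
  field
    ⋁     : {I : Set (c ⊔ ι)} → (I → Carrier) → Carrier
    ⋀     : {I : Set (c ⊔ ι)} → (I → Carrier) → Carrier
    ⋁-lub : {I : Set (c ⊔ ι)} (d : I → Carrier) → IsLub poset d (⋁ d)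
    ⋀-glb : {I : Set (c ⊔ ι)} (d : I → Carrier) → IsGlb poset d (⋀ d)

  Directed : {I : Set (c ⊔ ι)} → (I → Carrier) → Set (c ⊔ ℓ₂ ⊔ ι)
  Directed = IsDirected poset

  Compact : Carrier → Set (lsuc (c ⊔ ι) ⊔ ℓ₂)
  Compact k = {I : Set (c ⊔ ι)} (d : I → Carrier) → Directed d →
              k ≤ ⋁ d → ∃ λ j → k ≤ d j

record AlgebraicLattice (c ℓ₁ ℓ₂ ι : Level) : Set (lsuc (c ⊔ ℓ₁ ⊔ ℓ₂ ⊔ ι)) where
  field
    completeLattice : CompleteLattice c ℓ₁ ℓ₂ ι
  open CompleteLattice completeLattice public
  field
    algebraic : ∀ x → Σ (Set (c ⊔ ι)) λ I → Σ (I → Carrier) λ k →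
                (∀ j → Compact (k j)) × IsLub poset k x

record ALHom (L M : AlgebraicLattice c ℓ₁ ℓ₂ ι) : Set (lsuc (c ⊔ ι) ⊔ ℓ₁ ⊔ ℓ₂) where
  private
    module L = AlgebraicLattice L
    module M = AlgebraicLattice M
  field
    to         : L.Carrier → M.Carrier
    to-cong    : ∀ {x y} → x L.≈ y → to x M.≈ to y
    preserves⋀ : {I : Set (c ⊔ ι)} (d : I → L.Carrier) →
                 to (L.⋀ d) M.≈ M.⋀ (to ∘ d)
    preserves⋁ : {I : Set (c ⊔ ι)} (d : I → L.Carrier) → L.Directed d →
                 to (L.⋁ d) M.≈ M.⋁ (to ∘ d)

------------------------------------------------------------------------
-- Filter pairs

-- Equality of homomorphisms is pointwise, hence G-resp.
record FilterPair (S : Signature ℓ) (c ℓ₁ ℓ₂ : Level) :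
                  Set (lsuc (ℓ ⊔ c ⊔ ℓ₁ ⊔ ℓ₂)) where
  field
    G₀ : Structure S → AlgebraicLattice c ℓ₁ ℓ₂ ℓ

  module G (A : Structure S) = AlgebraicLattice (G₀ A)

  field
    G₁     : ∀ {A B} → Hom A B → ALHom (G₀ B) (G₀ A)
    G-resp : ∀ {A B} {g h : Hom A B} → fun g ≗ fun h →
             ∀ b → G._≈_ A (ALHom.to (G₁ g) b) (ALHom.to (G₁ h) b)
    G-id   : ∀ {A} a → G._≈_ A (ALHom.to (G₁ (idHom A)) a) a
    G-∘    : ∀ {A B C} (g : Hom B C) (h : Hom A B) z →
             G._≈_ A (ALHom.to (G₁ (g ∘ʰ h)) z)
                     (ALHom.to (G₁ h) (ALHom.to (G₁ g) z))

    i       : ∀ A → G.Carrier A → Pred ∣ A ∣ ℓ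
    i-cong  : ∀ A {a b} → G._≈_ A a b → i A a ≐ i A b
    i-⋀     : ∀ A {I : Set (c ⊔ ℓ)} (d : I → G.Carrier A) →
              i A (G.⋀ A d) ≐ ⋂ I (i A ∘ d)
    i-⋁     : ∀ A {I : Set (c ⊔ ℓ)} (d : I → G.Carrier A) → G.Directed A d →
              i A (G.⋁ A d) ≐ ⋃ I (i A ∘ d)
    natural : ∀ {A B} (h : Hom A B) (b : G.Carrier B) →
              i A (ALHom.to (G₁ h) b) ≐ fun h ⁻¹[ i B b ]

  i-mono : ∀ A {a b} → G._≤_ A a b → i A a ⊆ i A b
  i-mono A {a} {b} a≤b x∈a =
    proj₁ (i-⋀ A d) (proj₁ (i-cong A a≈⋀d) x∈a) (lift false)
    where
    d : Lift (c ⊔ ℓ) Bool → G.Carrier A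
    d (lift true)  = a
    d (lift false) = b
    a≈⋀d : G._≈_ A a (G.⋀ A d)
    a≈⋀d = G.antisym A
      (proj₂ (G.⋀-glb A d) a λ { (lift true) → G.refl A ; (lift false) → a≤b })
      (proj₁ (G.⋀-glb A d) (lift true))

  -- The left adjoint of i A, given by the usual formula
  -- Ξ A D = ⋀ { z | D ⊆ i A z }.
  Ξ : ∀ A → Pred ∣ A ∣ ℓ → G.Carrier A
  Ξ A D = G.⋀ A {I = Σ (G.Carrier A) λ z → D ⊆ i A z} proj₁

  Ξ-adjoint : ∀ A D z → G._≤_ A (Ξ A D) z ⇔ D ⊆ i A z
  Ξ-adjoint A D z = mk⇔ to from
    where
    d : (Σ (G.Carrier A) λ w → D ⊆ i A w) → G.Carrier A
    d = proj₁
    to : G._≤_ A (Ξ A D) z → D ⊆ i A z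
    to Ξ≤z x∈D = i-mono A Ξ≤z (proj₂ (i-⋀ A d) λ (_ , D⊆iw) → D⊆iw x∈D)
    from : D ⊆ i A z → G._≤_ A (Ξ A D) z
    from D⊆iz = proj₁ (G.⋀-glb A d) (z , D⊆iz)

  -- The consequence relation of the associated logic with variables X.
  Entails : (X : Set ℓ) → Pred (Term S X) ℓ → Term S X → Set (c ⊔ ℓ)
  Entails X Γ φ = ∀ a → Γ ⊆ i (Fm S X) a → φ ∈ i (Fm S X) a

------------------------------------------------------------------------
-- Filters of a logic, infinite sets

-- F is a filter on A for the logic given by the relation _⊢_ over Fm S X.
IsLogicFilter : {S : Signature ℓ} {X : Set ℓ} →
                (Pred (Term S X) ℓ → Term S X → Set r) →
                (A : Structure S) → Pred ∣ A ∣ ℓ → Set (lsuc ℓ ⊔ r)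
IsLogicFilter {S = S} {X} _⊢_ A F =
  ∀ Γ φ → Γ ⊢ φ → (v : Hom (Fm S X) A) →
  (∀ {γ} → γ ∈ Γ → fun v γ ∈ F) → fun v φ ∈ F

Infinite : Set ℓ → Set ℓ
Infinite X = ∀ n → ¬ (Fin n ↔ X)

{-# OPTIONS --safe #-}
-- The closure operator i ∘ Ξ is finitary, because i preserves directed joins,
-- and compatible with homomorphisms, because i is natural.  So φ ∈ i (Ξ F)
-- already holds for some finite Δ ⊆ F in place of F.  The finitely many
-- variables in Δ ∪ {φ} can be renamed injectively into the infinite set X,
-- which turns this into an entailment σ Δ ⊢ σ φ over X; a substitution undoing
-- the renaming then carries it back to Fm Z, where F is closed under it.
module Submission where

open import Defs
open import Axiom.ExcludedMiddle using (ExcludedMiddle)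
open import Data.Fin.Base using (zero; suc)
open import Data.List.Base as List
  using (List; []; _∷_; _++_; concatMap; deduplicate; length; lookup)
open import Data.List.Membership.Propositional as List using ()
open import Data.List.Membership.Propositional.Properties
  using (∈-++⁺ˡ; ∈-++⁺ʳ; ∈-map⁺; ∈-map⁻; ∈-lookup; ∈-deduplicate⁺; ∈-concatMap⁺)
open import Data.List.Relation.Binary.Subset.Propositional.Properties as Subset
  using (xs⊆xs++ys; xs⊆ys++xs)
open import Data.List.Relation.Unary.All as All using ()
open import Data.List.Relation.Unary.AllPairs using (_∷_)
open import Data.List.Relation.Unary.Any as Any using (here; there; index)
open import Data.List.Relation.Unary.Any.Properties using (lookup-index)
open import Data.List.Relation.Unary.Unique.DecPropositional.Properties
  using (deduplicate-!)
open import Data.List.Relation.Unary.Unique.Propositional using (Unique)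
open import Data.Product using (∃; ∃₂; _×_; _,_; proj₁; proj₂)
open import Data.Vec.Base as Vec using (Vec; []; _∷_)
open import Function.Base using (_∘_; const)
open import Function.Bundles using (Equivalence; mk↔ₛ′)
open import Level using (Level; Lift; lift)
open import Relation.Binary.Definitions using (DecidableEquality)
open import Relation.Binary.PropositionalEquality
  using (_≡_; _≢_; refl; sym; trans; cong; cong₂; subst)
open import Relation.Nullary using (¬_; yes; no; contradiction)
open import Relation.Nullary.Decidable using (decidable-stable)
open import Relation.Unary using (Pred; _∈_; _⊆_; _≐_)
  renaming (_⊢_ to _⁻¹[_])

private variable
  ℓ c ℓ₁ ℓ₂ : Level

lookup-injective : {A : Set ℓ} {xs : List A} → Unique xs →
                   ∀ j k → lookup xs j ≡ lookup xs k → j ≡ k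
lookup-injective (_ ∷ _)   zero    zero    _  = refl
lookup-injective (px ∷ _)  zero    (suc k) eq =
  contradiction eq (All.lookup px (∈-lookup k))
lookup-injective (px ∷ _)  (suc j) zero    eq =
  contradiction (sym eq) (All.lookup px (∈-lookup j))
lookup-injective (_ ∷ pxs) (suc j) (suc k) eq =
  cong suc (lookup-injective pxs j k eq)

-- `Infinite` rules out only exact bijections with some `Fin n`, so repetitions are removed first;
-- `lookup` on the deduplicated list is then injective as well as onto.
infinite⇒not-enumerated : {X : Set ℓ} → DecidableEquality X → Infinite X →
                          (xs : List X) → ¬ (∀ x → x List.∈ xs)
infinite⇒not-enumerated {X = X} _≟_ inf xs enum =
  inf (length ys) (mk↔ₛ′ (lookup ys) (index ∘ mem) lookup∘index
    λ j → lookup-injective (deduplicate-! _≟_ xs) _ j (lookup∘index (lookup ys j)))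
  where
  ys : List X
  ys = deduplicate _≟_ xs
  mem : ∀ x → x List.∈ ys
  mem x = ∈-deduplicate⁺ _≟_ (enum x)
  lookup∘index : ∀ x → lookup ys (index (mem x)) ≡ x
  lookup∘index x = sym (lookup-index (mem x))

-- `Infinite` is a negative statement and yields no element by itself. Excluded middle decides
-- equality on `X` and removes both double negations.
fresh : ExcludedMiddle ℓ → {X : Set ℓ} → Infinite X →
        (xs : List X) → ∃ λ x → ¬ (x List.∈ xs)
fresh em inf xs = decidable-stable em λ none →
  infinite⇒not-enumerated (λ _ _ → em) inf xs λ x →
    decidable-stable em λ x∉xs → none (x , x∉xs)

module _ {a b} {A : Set a} {B : Set b} (_≟_ : DecidableEquality A) where

  _[_↦_] : (A → B) → A → B → A → B
  (f [ x ↦ y ]) x′ with x′ ≟ x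
  ... | yes _ = y
  ... | no  _ = f x′

  updated : ∀ f x y → (f [ x ↦ y ]) x ≡ y
  updated f x y with x ≟ x
  ... | yes _   = refl
  ... | no  x≢x = contradiction refl x≢x

  not-updated : ∀ f x y {x′} → x′ ≢ x → (f [ x ↦ y ]) x′ ≡ f x′
  not-updated f x y {x′} x′≢x with x′ ≟ x
  ... | yes x′≡x = contradiction x′≡x x′≢x
  ... | no  _    = refl

-- The target of τ is W rather than Z since Z may be empty when zs is.
rename : ExcludedMiddle ℓ → {X Z W : Set ℓ} → Infinite X → (e : Z → W) → W →
         (zs : List Z) → ∃₂ λ (σ : Z → X) (τ : X → W) →
         ∀ {z} → z List.∈ zs → τ (σ z) ≡ e z
-- Freshness for the empty list provides an element of `X`, an arbitrary constant value for `σ`.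
rename em inf e w [] = const (proj₁ (fresh em inf [])) , const w , λ ()
rename em {X} {Z} inf e w (z ∷ zs)
  with rename em inf e w zs | em {P = z List.∈ zs}
... | σ , τ , τσ≡e | yes z∈zs =
  σ , τ , λ { (here refl) → τσ≡e z∈zs ; (there z′∈zs) → τσ≡e z′∈zs }
... | σ , τ , τσ≡e | no  z∉zs = σ′ , τ′ , λ where
    (here refl) → trans (cong τ′ (updated _≟_ σ z x)) (updated _≟_ τ x (e z))
    -- Neither update disturbs the tail: `z′` differs from `z` because `z` is not in `zs`, and
    -- `σ z′` differs from `x` because `x` avoids the image of `zs`.
    (there z′∈zs) → trans
      (cong τ′ (not-updated _≟_ σ z x λ { refl → z∉zs z′∈zs }))
      (trans
        (not-updated _≟_ τ x (e z) λ σz′≡x →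
          x∉ (subst (List._∈ List.map σ zs) σz′≡x (∈-map⁺ σ z′∈zs)))
        (τσ≡e z′∈zs))
  where
  -- Polymorphic, since `σ` is updated by comparing in `Z` and `τ` by comparing in `X`.
  _≟_ : {A : Set _} → DecidableEquality A
  _ ≟ _ = em
  x  = proj₁ (fresh em inf (List.map σ zs))
  x∉ = proj₂ (fresh em inf (List.map σ zs))
  σ′ = _[_↦_] _≟_ σ z x
  τ′ = _[_↦_] _≟_ τ x (e z)

module _ {S : Signature ℓ} {Z : Set ℓ} where

  vars  : Term S Z → List Z
  varss : ∀ {n} → Vec (Term S Z) n → List Z
  vars (var z)    = z ∷ []
  vars (app _ ts) = varss ts
  varss []       = []
  varss (t ∷ ts) = vars t ++ varss ts

  module _ (h : Hom (Fm S Z) (Fm S Z)) where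
    Fixes : List Z → Set ℓ
    Fixes zs = ∀ {z} → z List.∈ zs → fun h (var z) ≡ var z

    -- Meant for renaming followed by its undoing, a composite that need be the identity only on
    -- finitely many variables.
    fixes-term  : ∀ t → Fixes (vars t) → fun h t ≡ t
    fixes-terms : ∀ {n} (ts : Vec (Term S Z) n) → Fixes (varss ts) →
                  Vec.map (fun h) ts ≡ ts
    fixes-term (var _)    fix = fix (here refl)
    fixes-term (app f ts) fix =
      trans (Hom.hom h f ts) (cong (app f) (fixes-terms ts fix))
    fixes-terms []       _   = refl
    fixes-terms (t ∷ ts) fix =
      cong₂ _∷_ (fixes-term t (fix ∘ ∈-++⁺ˡ))
                (fixes-terms ts (fix ∘ ∈-++⁺ʳ (vars t)))

module _ {S : Signature ℓ} (P : FilterPair S c ℓ₁ ℓ₂) where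
  open FilterPair P

  Cl : ∀ A → Pred ∣ A ∣ ℓ → Pred ∣ A ∣ ℓ
  Cl A D = i A (Ξ A D)

  Cl-extensive : ∀ A D → D ⊆ Cl A D
  Cl-extensive A D = Equivalence.to (Ξ-adjoint A D (Ξ A D)) (G.refl A)

  Cl-least : ∀ A D z → D ⊆ i A z → Cl A D ⊆ i A z
  Cl-least A D z D⊆iz = i-mono A (Equivalence.from (Ξ-adjoint A D z) D⊆iz)

  Ξ-mono : ∀ A {D E} → D ⊆ E → G._≤_ A (Ξ A D) (Ξ A E)
  Ξ-mono A {D} {E} D⊆E =
    Equivalence.from (Ξ-adjoint A D (Ξ A E)) (Cl-extensive A E ∘ D⊆E)

  -- The elements `Ξ Δ`, for finite lists `Δ` from `D`, form a directed family, and `i` sends its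
  -- join to a union. Entries of `Δ` carry their proofs of membership in `D`.
  Cl-finitary : ∀ A D {φ} → φ ∈ Cl A D →
                ∃ λ (Δ : List (∃ D)) → φ ∈ Cl A (List._∈ List.map proj₁ Δ)
  Cl-finitary A D φ∈ with proj₁ (i-⋁ A d directed) (Cl-least A D (G.⋁ A d) covers φ∈)
    where
    -- `Lift` raises the lists to the universe of index types for joins.
    d : Lift c (List (∃ D)) → G.Carrier A
    d (lift Δ) = Ξ A (List._∈ List.map proj₁ Δ)
    directed : G.Directed A d
    directed = lift [] , λ (lift Δ) (lift Θ) → lift (Δ ++ Θ) ,
      Ξ-mono A (Subset.map⁺ proj₁ (xs⊆xs++ys Δ Θ)) ,
      Ξ-mono A (Subset.map⁺ proj₁ (xs⊆ys++xs Θ Δ))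
    covers : D ⊆ i A (G.⋁ A d)
    -- Singleton lists already cover `D`.
    covers {x} x∈D = proj₂ (i-⋁ A d directed)
      (lift ((x , x∈D) ∷ []) , Cl-extensive A _ (here refl))
  ... | lift Δ , φ∈Δ = Δ , φ∈Δ

  -- By naturality the preimage is `i A` of an element of the lattice of `A`, so leastness of the
  -- closure applies.
  Cl-natural : ∀ {A B} (h : Hom A B) D b →
               D ⊆ fun h ⁻¹[ i B b ] → Cl A D ⊆ fun h ⁻¹[ i B b ]
  Cl-natural {A} h D b D⊆ = proj₁ (natural h b) ∘
    Cl-least A D (ALHom.to (G₁ h) b) (proj₂ (natural h b) ∘ D⊆)

  filter-closed : ExcludedMiddle ℓ → {X : Set ℓ} → Infinite X →
                  {Z : Set ℓ} (F : Pred (Term S Z) ℓ) →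
                  IsLogicFilter (Entails X) (Fm S Z) F → Cl (Fm S Z) F ⊆ F
  filter-closed em {X} inf {Z} F filt {φ} φ∈
    with Cl-finitary (Fm S Z) F φ∈
  ... | Δ , φ∈Δ
    -- With `e = var` the map `τ` is a substitution; `φ` serves as the default term, available even
    -- when `Z` is empty.
    with rename em inf var φ (vars φ ++ concatMap vars (List.map proj₁ Δ))
  ... | σ , τ , τσ≡var =
    subst F (restores φ ∈-++⁺ˡ) (filt σΔ (fun σʰ φ) σΔ⊢σφ τʰ τσΔ⊆F)
    where
    Γ = List.map proj₁ Δ
    σʰ : Hom (Fm S Z) (Fm S X)
    σʰ = extend (Fm S X) (var ∘ σ)
    τʰ : Hom (Fm S X) (Fm S Z)
    τʰ = extend (Fm S Z) τ
    σΔ : Pred (Term S X) ℓ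
    σΔ = List._∈ List.map (fun σʰ) Γ

    restores : ∀ t → (∀ {z} → z List.∈ vars t → z List.∈ vars φ ++ concatMap vars Γ) →
               fun τʰ (fun σʰ t) ≡ t
    restores t ⊆V = fixes-term (τʰ ∘ʰ σʰ) t (τσ≡var ∘ ⊆V)

    σΔ⊢σφ : Entails X σΔ (fun σʰ φ)
    σΔ⊢σφ a σΔ⊆ = Cl-natural σʰ (List._∈ Γ) a (σΔ⊆ ∘ ∈-map⁺ (fun σʰ)) φ∈Δ

    τσΔ⊆F : ∀ {γ} → γ ∈ σΔ → fun τʰ γ ∈ F
    τσΔ⊆F γ∈ with ∈-map⁻ (fun σʰ) γ∈
    ... | δ , δ∈Γ , refl with ∈-map⁻ proj₁ δ∈Γ
    -- The term at hand is the image of some `δ` in `Γ`; undoing the renaming returns `δ`, whose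
    -- membership in `F` was stored in `Δ`.
    ... | (_ , δ∈F) , _ , refl = subst F
      (sym (restores δ λ z∈δ → ∈-++⁺ʳ (vars φ)
        (∈-concatMap⁺ vars (Any.map (λ { refl → z∈δ }) δ∈Γ))))
      δ∈F

proposition2p14 : ∀ {ℓ c ℓ₁ ℓ₂} → ExcludedMiddle ℓ →
    (S : Signature ℓ) (P : FilterPair S c ℓ₁ ℓ₂) → let open FilterPair P in
    (X : Set ℓ) → Infinite X →
    (Z : Set ℓ) (F : Pred (Term S Z) ℓ) →
    IsLogicFilter (Entails X) (Fm S Z) F →
    (F ≐ i (Fm S Z) (Ξ (Fm S Z) F)) × (∃ λ a → i (Fm S Z) a ≐ F)
proposition2p14 em S P X inf Z F filt =
  -- The element `Ξ F` witnesses that `F` lies in the image of `i`, so the same two inclusions serve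
  -- both conjuncts.
  (extensive , closed) , (FilterPair.Ξ P (Fm S Z) F , closed , extensive)
  where
  extensive = λ {t} → Cl-extensive P (Fm S Z) F {t}
  closed    = λ {t} → filter-closed P em inf F filt {t}
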